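{- Let $X=\prod_{i=1}^n\{0,\dots,m_i\}$, $f\colon X\to X$, and $f^b=\beta\circ f\circ\beta^{ -1}\colon\mathcal{A}\to\mathcal{A}$. Suppose that the asynchronous dynamics $AD_f$ admits a cyclic attractor $C$. Then the graph $G_{f^b}(\beta(C))$ contains a negative cycle.
   Context: $m_i\ge1$, $m=\sum_i m_i$; coordinates of $\{0,1\}^m$ are indexed by $I=\{(i,j)\mid 1\le i\le n,\,1\le j\le m_i\}$. $\beta\colon X\to\{0,1\}^m$ is given by $\beta_{i,j}(x)=1$ iff $x_i\ge j$; $\mathcal{A}=\beta(X)$. $e^k$ is the $k$-th unit vector, $\mathrm{sign}(0)=0$. The asynchronous dynamics $AD_f$ is the directed graph on $X$ with an edge $(x,x+se^i)$ whenever $s=\mathrm{sign}(f_i(x)-x_i)\ne0$. A nonempty $T\subseteq X$ is a trap set if every edge leaving a state of $T$ ends in $T$; attractors are the inclusion-minimal trap sets; an attractor is cyclic if it has more than one state. For a map $g\colon Y\to Y$, $Y$ a set of integer vectors with coordinates indexed by a finite set $J$, the local interaction graph $G_g(z)$ at $z\in Y$ has vertex set $J$ and an edge from $j$ to $i$ with sign $s_1\,\mathrm{sign}(g_i(z+s_1e^j)-g_i(z))$ whenever $s_1\in\{ -1,1\}$, $z+s_1e^j\in Y$ and this sign is nonzero. For $S\subseteq Y$, $G_g(S)$ is the signed graph on $J$ containing an edge $j\to i$ of sign $s$ iff $G_g(z)$ contains it for some $z\in S$. Cycles are elementary directed cycles (loops allowed), with sign the product of edge signs. -}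

module Defs where

open import Data.Nat as ℕ using (ℕ; zero; suc; _≤_; _<?_)
open import Data.Nat.DivMod using (_%_; m%n<n)
open import Data.Integer as ℤ using (ℤ; +_; -_; _*_; _-_; _+_)
open import Data.Fin using (Fin; zero; suc; toℕ; fromℕ<)
open import Data.Vec using (Vec; lookup; _[_]≔_)
open import Data.Product using (Σ; ∃; ∃-syntax; _×_; _,_)
open import Data.Sum using (_⊎_)
open import Relation.Nullary using (¬_; does)
open import Relation.Binary.PropositionalEquality using (_≡_; _≢_)
open import Data.Bool using (if_then_else_)

sgn : ℤ → ℤ
sgn (+ zero)    = + 0
sgn (+ (suc _)) = + 1
sgn ℤ.-[1+ _ ]  = - (+ 1)

prodFin : ∀ {k} → (Fin k → ℤ) → ℤ
prodFin {zero}  s = + 1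
prodFin {suc k} s = s zero * prodFin (λ t → s (suc t))

next : ∀ {k} → Fin (suc k) → Fin (suc k)
next {k} t = fromℕ< (m%n<n (suc (toℕ t)) (suc k))

module Network (n : ℕ) (m : Fin n → ℕ) where

  InX : Vec ℕ n → Set
  InX x = ∀ i → lookup x i ≤ m i

  -- the index set I = {(i,j) | 1 ≤ j ≤ m_i}; (i , k) with k : Fin (m i) stands for j = k+1
  I : Set
  I = Σ (Fin n) (λ i → Fin (m i))

  -- β_{i,j}(x) = 1 iff x_i ≥ j  (i.e. k < x_i for j = k+1)
  β : Vec ℕ n → I → ℤ
  β x (i , k) = if does (toℕ k <? lookup x i) then + 1 else + 0

  -- x + s eⁱ (used only when the result stays in ℕⁿ)
  shift : Vec ℕ n → Fin n → ℤ → Vec ℕ n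
  shift x i s = x [ i ]≔ ℤ.∣ + lookup x i + s ∣

  module Dyn (f : Vec ℕ n → Vec ℕ n) where

    ADEdge : Vec ℕ n → Vec ℕ n → Set
    ADEdge x y = InX x × ∃[ i ] ∃[ s ]
      (s ≡ sgn (+ lookup (f x) i - + lookup x i) × s ≢ + 0 × y ≡ shift x i s)

    TrapSet : (Vec ℕ n → Set) → Set
    TrapSet T = (∃[ x ] T x) × (∀ x → T x → InX x)
              × (∀ x y → T x → ADEdge x y → T y)

    Attractor : (Vec ℕ n → Set) → Set₁
    Attractor C = TrapSet C ×
      ((T : Vec ℕ n → Set) → TrapSet T → (∀ x → T x → C x) → ∀ x → C x → T x)

    Cyclic : (Vec ℕ n → Set) → Set
    Cyclic C = ∃[ x ] ∃[ y ] (C x × C y × x ≢ y)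

    -- z ∈ 𝒜 = β(X), witnessed by a preimage y (pointwise equality of bit vectors)
    -- f^b = β ∘ f ∘ β⁻¹ : for z = β y with y ∈ X, f^b(z) = β (f y).
    -- Edge j → i of sign s in G_{f^b}(β(C)): there are x ∈ C (so z = β x),
    -- s₁ ∈ {1,-1} and y ∈ X with β y = z + s₁ eʲ, and
    -- s = s₁ · sign(f^b_i(z + s₁ eʲ) − f^b_i(z)) ≠ 0.
    GEdge : (Vec ℕ n → Set) → I → I → ℤ → Set
    GEdge C j i s = ∃[ x ] (C x × ∃[ s₁ ] ((s₁ ≡ + 1 ⊎ s₁ ≡ - (+ 1)) × ∃[ y ]
      (InX y × β y j ≡ β x j + s₁ × (∀ k → k ≢ j → β y k ≡ β x k)
       × s ≡ s₁ * sgn (β (f y) i - β (f x) i) × s ≢ + 0)))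

    NegativeCycle : (I → I → ℤ → Set) → Set
    NegativeCycle E = Σ ℕ λ k → Σ (Fin (suc k) → I) λ v → Σ (Fin (suc k) → ℤ) λ s →
      ((∀ a b → v a ≡ v b → a ≡ b)
       × (∀ (t : Fin (suc k)) → E (v t) (v (next t)) (s t))
       × prodFin s ≡ - (+ 1))

{-# OPTIONS --safe #-}
module Submission where

-- Call j → l an influence if flipping the bit j along a transition inside C changes the bit l of f.
-- Take an initial strong component of the double cover (coordinates with signs) of the graph of
-- influences, starting from a coordinate that flips in C. If it contains both copies of some
-- coordinate, there is a negative closed walk, and erasing its positive loops leaves a negative
-- cycle. Otherwise it labels a set K of coordinates by signs with respect to which f is increasing
-- on K along transitions, and f on K does not depend on the flips outside K. One then reaches a
-- state of C at which f fixes all bits of K, by tuning one component of x after the other: each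
-- step of the next component c towards its target is followed by a cascade of the components tuned
-- before, in the same direction. By monotonicity the cascade preserves the bit of f that made c
-- move, hence c never overshoots, although the labels of the bits of one component may differ.
-- From that state on K is frozen, which is absurd since C is strongly connected and K flips in C.

open import Defs
open import Level using (0ℓ)
open import Data.Bool using (Bool; true; false; not; if_then_else_)
open import Data.Bool.Properties using (¬-not) renaming (_≟_ to _≟ᵇ_)
open import Data.Nat using (ℕ; zero; suc; _≤_; _<_; _≤?_; _<?_; _≟_; _+_; s≤s; s≤s⁻¹)
open import Data.Nat.DivMod using (_%_; m<n⇒m%n≡m; n%n≡0)
open import Data.Nat.Properties hiding (_≟_; _≤?_; _<?_; suc-injective)
open import Data.Integer as ℤ using (ℤ; _◃_; _⊖_; +_; -_)
open import Data.Integer.Properties using (m-n≡m⊖n; n⊖n≡0; [1+m]⊖[1+n]≡m⊖n)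
open import Data.Fin as Fin using (Fin; zero; suc; toℕ; fromℕ; fromℕ<; inject₁)
open import Data.Fin.Properties
  using (all?; toℕ-injective; toℕ-fromℕ<; toℕ-fromℕ; toℕ-inject₁; toℕ<n; inject₁-injective; fromℕ≢inject₁)
open import Data.Fin.Relation.Unary.Top using (view; ‵fromℕ; ‵inject₁)
open import Data.List
  using (List; []; _∷_; length; filter; upTo; allFin; map; concatMap; cartesianProduct; cartesianProductWith)
open import Data.List.Membership.Propositional using (_∈_; _∉_; lose; find)
open import Data.List.Membership.Propositional.Properties
  using (∈-allFin; ∈-map⁺; ∈-concatMap⁺; ∈-cartesianProduct⁺; ∈-cartesianProductWith⁺; ∈-upTo⁺; ∈-filter⁺)
open import Data.List.Properties using (filter-notAll)
open import Data.List.Relation.Unary.Any using (Any; here; there; any?)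
open import Data.Product using (Σ; ∃-syntax; _×_; _,_; proj₁; proj₂)
import Data.Product.Properties as Product
open import Data.Sign as Sign using (Sign) renaming (_*_ to _·_)
open import Data.Sign.Properties using (s*s≡+)
  renaming (_≟_ to _≟ₛ_; *-assoc to ·-assoc; *-identityʳ to ·-identityʳ; *-cancelʳ-≡ to ·-cancelʳ)
open import Data.Sum using (_⊎_; inj₁; inj₂)
open import Data.Vec using (Vec; []; _∷_; lookup; _[_]≔_)
import Data.Vec.Functional as Vecᶠ
open import Data.Vec.Properties using (≡-dec; lookup∘update; lookup∘update′)
open import Function using (_∘_; case_of_)
open import Relation.Binary using (Rel; Decidable; DecidableEquality; tri<; tri≈; tri>)
open import Relation.Binary.Construct.Closure.ReflexiveTransitive using (Star; ε; _◅_; _◅◅_)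
open import Relation.Binary.PropositionalEquality
open import Relation.Nullary using (¬_; Dec; yes; no; does; contradiction; ¬?)
open import Relation.Nullary.Decidable using (map′; _⊎-dec_; _×-dec_; dec-true; dec-false; decidable-stable)
import Relation.Unary as U

-- Reachability in finite graphs

module Reachability {A : Set} {E : Rel A 0ℓ} (_≟_ : DecidableEquality A) (E? : Decidable E)
  (vertices : List A) (complete : ∀ {a b} → E a b → a ∈ vertices) where

  -- Floyd–Warshall: paths of which all inner vertices lie in the list.
  Via : List A → Rel A 0ℓ
  Via []       a b = a ≡ b ⊎ E a b
  Via (v ∷ vs) a b = Via vs a b ⊎ (Via vs a v × Via vs v b)

  Via? : ∀ vs → Decidable (Via vs)
  Via? []       a b = (a ≟ b) ⊎-dec E? a b
  Via? (v ∷ vs) a b = Via? vs a b ⊎-dec (Via? vs a v ×-dec Via? vs v b)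

  via-base : ∀ vs {a b} → a ≡ b ⊎ E a b → Via vs a b
  via-base []       p = p
  via-base (v ∷ vs) p = inj₁ (via-base vs p)

  -- Paths need not be simple: if both halves pass through the head of the list, the detour between
  -- the two passages is dropped; if `v` is the head itself, each half is cut there.
  via-splice : ∀ vs {a v b} → v ∈ vs → Via vs a v → Via vs v b → Via vs a b
  via-splice (v ∷ vs) (here refl) p q = inj₂ (to-head p , from-head q)
    where
    to-head : ∀ {a} → Via (v ∷ vs) a v → Via vs a v
    to-head (inj₁ r)       = r
    to-head (inj₂ (r , _)) = r
    from-head : ∀ {b} → Via (v ∷ vs) v b → Via vs v b
    from-head (inj₁ r)       = r
    from-head (inj₂ (_ , r)) = r
  via-splice (_ ∷ vs) (there v∈) (inj₁ p)       (inj₁ q)       = inj₁ (via-splice vs v∈ p q)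
  via-splice (_ ∷ vs) (there v∈) (inj₁ p)       (inj₂ (q , r)) = inj₂ (via-splice vs v∈ p q , r)
  via-splice (_ ∷ vs) (there v∈) (inj₂ (p , q)) (inj₁ r)       = inj₂ (p , via-splice vs v∈ q r)
  via-splice (_ ∷ vs) (there v∈) (inj₂ (p , _)) (inj₂ (_ , r)) = inj₂ (p , r)

  via-sound : ∀ vs {a b} → Via vs a b → Star E a b
  via-sound []       (inj₁ refl)    = ε
  via-sound []       (inj₂ e)       = e ◅ ε
  via-sound (v ∷ vs) (inj₁ p)       = via-sound vs p
  via-sound (v ∷ vs) (inj₂ (p , q)) = via-sound vs p ◅◅ via-sound vs q

  -- An inner vertex of a path is the source of its next edge, so it is enough that `complete` lists
  -- sources.
  via-complete : ∀ {a b} → Star E a b → Via vertices a b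
  via-complete ε                = via-base vertices (inj₁ refl)
  via-complete (e ◅ ε)          = via-base vertices (inj₂ e)
  via-complete (e ◅ p@(e′ ◅ _)) =
    via-splice vertices (complete e′) (via-base vertices (inj₂ e)) (via-complete p)

  reachable? : Decidable (Star E)
  reachable? a b = map′ (via-sound vertices) via-complete (Via? vertices a b)

  -- One pass over the vertices suffices: the candidate is replaced by any `q` that reaches it, and
  -- vertices treated earlier stay harmless because `q` reaches whatever the old candidate reached.
  initialVertex : ∀ p → ∃[ p′ ] (Star E p′ p × (∀ q → Star E q p′ → Star E p′ q))
  initialVertex p = let p′ , p′⇝p , univ = go vertices in p′ , p′⇝p , λ where
      q ε          → ε
      q r@(e ◅ _) → univ q (complete e) r
    where
    go : ∀ qs → ∃[ p′ ] (Star E p′ p × (∀ q → q ∈ qs → Star E q p′ → Star E p′ q))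
    go []       = p , ε , λ _ ()
    go (q ∷ qs) with go qs
    ... | p₁ , p₁⇝p , univ with reachable? q p₁
    ...   | yes q⇝p₁ = q , q⇝p₁ ◅◅ p₁⇝p , λ where
              _ (here refl) r → r
              x (there x∈)  r → q⇝p₁ ◅◅ univ x x∈ (r ◅◅ q⇝p₁)
    ...   | no ¬q⇝p₁ = p₁ , p₁⇝p , λ where
              _ (here refl) r → contradiction r ¬q⇝p₁
              x (there x∈)  r → univ x x∈ r

-- Cycles in signed graphs

next-inject₁ : ∀ {k} (t : Fin k) → next (inject₁ t) ≡ suc t
next-inject₁ {k} t = toℕ-injective (begin
  toℕ (next (inject₁ t))          ≡⟨ toℕ-fromℕ< _ ⟩
  suc (toℕ (inject₁ t)) % suc k   ≡⟨ cong (λ a → suc a % suc k) (toℕ-inject₁ t) ⟩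
  suc (toℕ t) % suc k             ≡⟨ m<n⇒m%n≡m (s≤s (toℕ<n t)) ⟩
  suc (toℕ t)                     ∎)
  where open ≡-Reasoning

next-fromℕ : ∀ k → next (fromℕ k) ≡ zero
next-fromℕ k = toℕ-injective (begin
  toℕ (next (fromℕ k))          ≡⟨ toℕ-fromℕ< _ ⟩
  suc (toℕ (fromℕ k)) % suc k   ≡⟨ cong (λ a → suc a % suc k) (toℕ-fromℕ k) ⟩
  suc k % suc k                 ≡⟨ n%n≡0 (suc k) ⟩
  0                             ∎)
  where open ≡-Reasoning

◃-homo-* : ∀ s t → (s ◃ 1) ℤ.* (t ◃ 1) ≡ (s · t) ◃ 1
◃-homo-* Sign.- Sign.- = refl
◃-homo-* Sign.- Sign.+ = refl
◃-homo-* Sign.+ Sign.- = refl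
◃-homo-* Sign.+ Sign.+ = refl

signProduct : ∀ {k} → (Fin k → Sign) → Sign
signProduct = Vecᶠ.foldr _·_ Sign.+

prodFin-signs : ∀ {k} (s : Fin k → Sign) → prodFin (λ t → s t ◃ 1) ≡ signProduct s ◃ 1
prodFin-signs {zero}  s = refl
prodFin-signs {suc k} s =
  trans (cong ((s zero ◃ 1) ℤ.*_) (prodFin-signs (s ∘ suc))) (◃-homo-* (s zero) _)

·-cancel-middle : ∀ a b c → (a · b) · (b · c) ≡ a · c
·-cancel-middle a b c = begin
  (a · b) · (b · c)   ≡⟨ ·-assoc a b (b · c) ⟩
  a · (b · (b · c))   ≡⟨ cong (a ·_) (·-assoc b b c) ⟨
  a · ((b · b) · c)   ≡⟨ cong (λ z → a · (z · c)) (s*s≡+ b) ⟩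
  a · c               ∎
  where open ≡-Reasoning

module SignedGraph {A : Set} (_≟_ : DecidableEquality A) (E : A → A → Sign → Set) where

  open import Data.List.Membership.DecPropositional _≟_ using (_∈?_)

  NegCycle : Set
  NegCycle = ∃[ k ] Σ (Fin (suc k) → A) λ v → Σ (Fin (suc k) → Sign) λ s →
    (∀ a b → v a ≡ v b → a ≡ b) × (∀ t → E (v t) (v (next t)) (s t)) × signProduct s ≡ Sign.-

  data SimplePath : A → A → Sign → List A → Set where
    nil  : ∀ {u} → SimplePath u u Sign.+ (u ∷ [])
    cons : ∀ {u v w s σ vs} → E u v s → SimplePath v w σ vs → u ∉ vs → SimplePath u w (s · σ) (u ∷ vs)

  splitAt : ∀ {u v w σ vs} → SimplePath v w σ vs → u ∈ vs →
    ∃[ σ₁ ] ∃[ vs₁ ] ∃[ σ₂ ] ∃[ vs₂ ] (SimplePath v u σ₁ vs₁ × SimplePath u w σ₂ vs₂ ×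
      σ ≡ σ₁ · σ₂ × (∀ {x} → x ∈ vs₁ → x ∈ vs))
  splitAt p@nil          (here refl) = _ , _ , _ , _ , nil , p , refl , λ { (here eq) → here eq }
  splitAt p@(cons _ _ _) (here refl) = _ , _ , _ , _ , nil , p , refl , λ { (here eq) → here eq }
  splitAt (cons {s = s} e p v∉) (there u∈) =
    let σ₁ , vs₁ , σ₂ , vs₂ , p₁ , p₂ , eq , sub = splitAt p u∈ in
    _ , _ , σ₂ , vs₂ , cons e p₁ (v∉ ∘ sub) , p₂ ,
    trans (cong (s ·_) eq) (sym (·-assoc s σ₁ σ₂)) ,
    λ { (here eq′) → here eq′ ; (there x∈) → there (sub x∈) }

  -- The indexed form of a simple path, as `NegCycle` wants it. The field `visits` turns `u ∉ vs`
  -- into injectivity when a vertex is prepended.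
  record Trace (u w : A) (σ : Sign) (vs : List A) : Set where
    field
      {len}     : ℕ
      vertex    : Fin (suc len) → A
      sign      : Fin len → Sign
      start     : vertex zero ≡ u
      end       : vertex (fromℕ len) ≡ w
      injective : ∀ a b → vertex a ≡ vertex b → a ≡ b
      edge      : ∀ t → E (vertex (inject₁ t)) (vertex (suc t)) (sign t)
      product   : signProduct sign ≡ σ
      visits    : ∀ t → vertex t ∈ vs

  trace : ∀ {u w σ vs} → SimplePath u w σ vs → Trace u w σ vs
  trace {u} nil = record
    { len = 0 ; vertex = λ _ → u ; sign = λ () ; start = refl ; end = refl
    ; injective = λ { zero zero _ → refl } ; edge = λ () ; product = refl ; visits = λ _ → here refl }
  trace {u} (cons {s = s} e p u∉) = record
    { vertex = u Vecᶠ.∷ T.vertex ; sign = s Vecᶠ.∷ T.sign ; start = refl ; end = T.end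
    ; injective = λ where
        zero    zero    _  → refl
        zero    (suc b) eq → contradiction (subst (_∈ _) (sym eq) (T.visits b)) u∉
        (suc a) zero    eq → contradiction (subst (_∈ _) eq (T.visits a)) u∉
        (suc a) (suc b) eq → cong suc (T.injective a b eq)
    ; edge = λ where
        zero    → subst (λ x → E u x s) (sym T.start) e
        (suc t) → T.edge t
    ; product = cong (s ·_) T.product
    ; visits = λ where
        zero    → here refl
        (suc t) → there (T.visits t) }
    where module T = Trace (trace p)

  -- The cycle lists `u` and then the path without its last vertex, which is `u` again.
  closePath : ∀ {u v s σ vs} → E u v s → SimplePath v u σ vs → s · σ ≡ Sign.- → NegCycle
  closePath {u} {v} {s} e p neg =
    T.len , vertex , s Vecᶠ.∷ T.sign , injective , edge , trans (cong (s ·_) T.product) neg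
    where
    module T = Trace (trace p)
    vertex : Fin (suc T.len) → A
    vertex = (u Vecᶠ.∷ T.vertex) ∘ inject₁
    last≢ : ∀ t → u ≢ T.vertex (inject₁ t)
    last≢ t eq = fromℕ≢inject₁ (T.injective _ _ (trans T.end eq))
    injective : ∀ a b → vertex a ≡ vertex b → a ≡ b
    injective zero    zero    _  = refl
    injective zero    (suc b) eq = contradiction eq (last≢ b)
    injective (suc a) zero    eq = contradiction (sym eq) (last≢ a)
    injective (suc a) (suc b) eq = cong suc (inject₁-injective (T.injective _ _ eq))
    vertex-next : ∀ t → vertex (next t) ≡ T.vertex t
    vertex-next t with view t
    -- Wrapping around leads to index 0, which holds `u`, the end of the path.
    ... | ‵fromℕ     = trans (cong vertex (next-fromℕ T.len)) (sym T.end)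
    ... | ‵inject₁ i = cong vertex (next-inject₁ i)
    edge′ : ∀ t → E (vertex t) (T.vertex t) ((s Vecᶠ.∷ T.sign) t)
    edge′ zero    = subst (λ x → E u x s) (sym T.start) e
    edge′ (suc t) = T.edge t
    edge : ∀ t → E (vertex t) (vertex (next t)) ((s Vecᶠ.∷ T.sign) t)
    edge t = subst (λ x → E (vertex t) x ((s Vecᶠ.∷ T.sign) t)) (sym (vertex-next t)) (edge′ t)

  -- Walks in the double cover are walks in the graph together with their sign.
  DoubleCover : Rel (A × Sign) 0ℓ
  DoubleCover (u , δ) (v , η) = E u v (δ · η)

  -- If the new first vertex already occurs on the simplified rest, the part up to that occurrence
  -- closes to a simple cycle. Either it is negative, or cutting it out leaves the sign unchanged.
  eraseLoops : ∀ {u w δ ε} → Star DoubleCover (u , δ) (w , ε) →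
    NegCycle ⊎ ∃[ vs ] SimplePath u w (δ · ε) vs
  eraseLoops {u} {δ = δ} ε = inj₂ (_ , subst (λ σ → SimplePath u u σ (u ∷ [])) (sym (s*s≡+ δ)) nil)
  eraseLoops {u} {w} {δ} {ε₁} (_◅_ {j = v , η} e r) with eraseLoops r
  ... | inj₁ c = inj₁ c
  ... | inj₂ (vs , p) with u ∈? vs
  ...   | no u∉ = inj₂ (_ , subst (λ σ → SimplePath u w σ _) (·-cancel-middle δ η ε₁) (cons e p u∉))
  ...   | yes u∈ with splitAt p u∈
  ...     | σ₁ , _ , σ₂ , vs₂ , p₁ , p₂ , eq , _ with (δ · η) · σ₁ in loop
  ...       | Sign.- = inj₁ (closePath e p₁ loop)
  ...       | Sign.+ = inj₂ (vs₂ , subst (λ σ → SimplePath u w σ vs₂) same-sign p₂)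
    where
    open ≡-Reasoning
    same-sign : σ₂ ≡ δ · ε₁
    same-sign = begin
      σ₂                     ≡⟨ cong (_· σ₂) loop ⟨
      ((δ · η) · σ₁) · σ₂    ≡⟨ ·-assoc (δ · η) σ₁ σ₂ ⟩
      (δ · η) · (σ₁ · σ₂)    ≡⟨ cong ((δ · η) ·_) eq ⟨
      (δ · η) · (η · ε₁)     ≡⟨ ·-cancel-middle δ η ε₁ ⟩
      δ · ε₁                 ∎

  end∈ : ∀ {u w σ vs} → SimplePath u w σ vs → w ∈ vs
  end∈ nil          = here refl
  end∈ (cons _ p _) = there (end∈ p)

  closedSimplePath-+ : ∀ {u w σ vs} → SimplePath u w σ vs → u ≡ w → σ ≡ Sign.+
  closedSimplePath-+ nil           _    = refl
  closedSimplePath-+ (cons _ p u∉) refl = contradiction (end∈ p) u∉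

  -- A simple path from `u` to `u` is trivial, hence positive, so erasing loops must meet a negative
  -- cycle.
  negativeWalk⇒NegCycle : ∀ {u} → Star DoubleCover (u , Sign.+) (u , Sign.-) → NegCycle
  negativeWalk⇒NegCycle r with eraseLoops r
  ... | inj₁ c       = c
  ... | inj₂ (_ , p) = contradiction (closedSimplePath-+ p refl) λ ()

-- Threshold bits

exceeds : ℕ → ℕ → Bool
exceeds v k = does (k <? v)

does-true : ∀ {P : Set} (P? : Dec P) → does P? ≡ true → P
does-true (yes p) _ = p

does-false : ∀ {P : Set} (P? : Dec P) → does P? ≡ false → ¬ P
does-false (no ¬p) _ = ¬p

exceeds-true : ∀ v k → exceeds v k ≡ true → k < v
exceeds-true v k = does-true (k <? v)

exceeds-false : ∀ v k → exceeds v k ≡ false → v ≤ k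
exceeds-false v k = ≮⇒≥ ∘ does-false (k <? v)

<⇒exceeds : ∀ {v k} → k < v → exceeds v k ≡ true
<⇒exceeds {v} {k} = dec-true (k <? v)

≤⇒¬exceeds : ∀ {v k} → v ≤ k → exceeds v k ≡ false
≤⇒¬exceeds {v} {k} = dec-false (k <? v) ∘ ≤⇒≯

-- The chain is `l < v ≤ k < u` if `b` is true, and `u ≤ k < v ≤ l` if it is false.
exceeds-chain : ∀ {u v} k l b → exceeds u k ≡ b → exceeds v k ≢ b → exceeds v l ≡ b → exceeds u l ≡ b
exceeds-chain {u} {v} k l true  uk vk vl =
  <⇒exceeds (<-≤-trans (<-≤-trans (exceeds-true v l vl) (exceeds-false v k (¬-not vk)))
                       (<⇒≤ (exceeds-true u k uk)))
exceeds-chain {u} {v} k l false uk vk vl =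
  ≤⇒¬exceeds (≤-trans (≤-trans (exceeds-false u k uk) (<⇒≤ (exceeds-true v k (¬-not vk))))
                      (exceeds-false v l vl))

-- The level next to the threshold k, on the side where the bit is b.
beside : Bool → ℕ → ℕ
beside true  k = suc k
beside false k = k

exceeds-beside : ∀ b k → exceeds (beside b k) k ≡ b
exceeds-beside true  k = <⇒exceeds (n<1+n k)
exceeds-beside false k = ≤⇒¬exceeds {k} {k} ≤-refl

exceeds-suc : ∀ {k l} → l ≢ k → exceeds (suc k) l ≡ exceeds k l
exceeds-suc {k} {l} l≢k with <-cmp l k
... | tri< l<k _ _ = trans (<⇒exceeds (m<n⇒m<1+n l<k)) (sym (<⇒exceeds l<k))
... | tri≈ _ l≡k _ = contradiction l≡k l≢k
... | tri> _ _ k<l = trans (≤⇒¬exceeds k<l) (sym (≤⇒¬exceeds (<⇒≤ k<l)))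

exceeds-beside-≢ : ∀ b {k l} → l ≢ k → exceeds (beside b k) l ≡ exceeds k l
exceeds-beside-≢ true  l≢k = exceeds-suc l≢k
exceeds-beside-≢ false _   = refl

-- Signs of differences and of bits

sgn-⊖-< : ∀ {a b} → a < b → sgn (a ⊖ b) ≡ - (+ 1)
sgn-⊖-< {zero}  {suc b} _         = refl
sgn-⊖-< {suc a} {suc b} (s≤s a<b) = trans (cong sgn ([1+m]⊖[1+n]≡m⊖n a b)) (sgn-⊖-< a<b)

sgn-⊖-> : ∀ {a b} → b < a → sgn (a ⊖ b) ≡ + 1
sgn-⊖-> {suc a} {zero}  _         = refl
sgn-⊖-> {suc a} {suc b} (s≤s b<a) = trans (cong sgn ([1+m]⊖[1+n]≡m⊖n a b)) (sgn-⊖-> b<a)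

sgn-difference-< : ∀ {a b} → a < b → sgn (+ a ℤ.- + b) ≡ - (+ 1)
sgn-difference-< {a} {b} a<b = trans (cong sgn (m-n≡m⊖n a b)) (sgn-⊖-< a<b)

sgn-difference-> : ∀ {a b} → b < a → sgn (+ a ℤ.- + b) ≡ + 1
sgn-difference-> {a} {b} b<a = trans (cong sgn (m-n≡m⊖n a b)) (sgn-⊖-> b<a)

sgn-difference-≡ : ∀ a → sgn (+ a ℤ.- + a) ≡ + 0
sgn-difference-≡ a = cong sgn (trans (m-n≡m⊖n a a) (n⊖n≡0 a))

sg : Bool → Sign
sg true  = Sign.+
sg false = Sign.-

sg-injective : ∀ {a b} → sg a ≡ sg b → a ≡ b
sg-injective {true}  {true}  _ = refl
sg-injective {false} {false} _ = refl

sg-flips : ∀ {a b δ ρ} → a ≢ b → sg a · δ ≢ ρ → sg b · δ ≡ ρ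
sg-flips {true}  {true}  a≢b _ = contradiction refl a≢b
sg-flips {false} {false} a≢b _ = contradiction refl a≢b
sg-flips {true}  {false} {Sign.+} {Sign.+} _ p = contradiction refl p
sg-flips {true}  {false} {Sign.+} {Sign.-} _ _ = refl
sg-flips {true}  {false} {Sign.-} {Sign.+} _ _ = refl
sg-flips {true}  {false} {Sign.-} {Sign.-} _ p = contradiction refl p
sg-flips {false} {true}  {Sign.+} {Sign.+} _ _ = refl
sg-flips {false} {true}  {Sign.+} {Sign.-} _ p = contradiction refl p
sg-flips {false} {true}  {Sign.-} {Sign.+} _ p = contradiction refl p
sg-flips {false} {true}  {Sign.-} {Sign.-} _ _ = refl

toℤ : Bool → ℤ
toℤ b = if b then + 1 else + 0

sg-±1 : ∀ b → sg b ◃ 1 ≡ + 1 ⊎ sg b ◃ 1 ≡ - (+ 1)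
sg-±1 true  = inj₁ refl
sg-±1 false = inj₂ refl

toℤ-not : ∀ b → toℤ (not b) ≡ toℤ b ℤ.+ (sg (not b) ◃ 1)
toℤ-not true  = refl
toℤ-not false = refl

-- Both factors on the right describe the bits after the flip, both on the left the bits before it;
-- the two changes of sign cancel.
sg-product : ∀ a {b c} → c ≢ b →
  (sg a · sg b) ◃ 1 ≡ (sg (not a) ◃ 1) ℤ.* sgn (toℤ c ℤ.- toℤ b)
sg-product a     {true}  {true}  c≢b = contradiction refl c≢b
sg-product a     {false} {false} c≢b = contradiction refl c≢b
sg-product true  {true}  {false} _   = refl
sg-product true  {false} {true}  _   = refl
sg-product false {true}  {false} _   = refl
sg-product false {false} {true}  _   = refl

◃1≢0 : ∀ s → s ◃ 1 ≢ + 0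
◃1≢0 Sign.+ ()
◃1≢0 Sign.- ()

box : ∀ n → (Fin n → ℕ) → List (Vec ℕ n)
box zero    m = [] ∷ []
box (suc n) m = cartesianProductWith _∷_ (upTo (suc (m zero))) (box n (m ∘ suc))

∈-box : ∀ {n} {m : Fin n → ℕ} (x : Vec ℕ n) → (∀ i → lookup x i ≤ m i) → x ∈ box n m
∈-box []      _   = here refl
∈-box (a ∷ x) x≤m = ∈-cartesianProductWith⁺ _∷_ (∈-upTo⁺ (s≤s (x≤m zero))) (∈-box x (x≤m ∘ suc))

-- Asynchronous transitions as flips of threshold bits

module Dynamics (n : ℕ) (m : Fin n → ℕ) (f : Vec ℕ n → Vec ℕ n)
  (f-InX : ∀ x → Network.InX n m x → Network.InX n m (f x)) where

  open Network n m
  open Dyn f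

  _≟ᴵ_ : DecidableEquality I
  _≟ᴵ_ = Product.≡-dec Fin._≟_ Fin._≟_

  coords : List I
  coords = concatMap (λ i → map (i ,_) (allFin (m i))) (allFin n)

  ∈-coords : ∀ l → l ∈ coords
  ∈-coords (i , k) = ∈-concatMap⁺ _ (lose (∈-allFin i) (∈-map⁺ (i ,_) (∈-allFin k)))

  bit : Vec ℕ n → I → Bool
  bit x (i , k) = exceeds (lookup x i) (toℕ k)

  -- Flips the bit j, provided that x_i is one of the two levels beside the threshold.
  move : Vec ℕ n → I → Vec ℕ n
  move x (i , k) = x [ i ]≔ beside (not (bit x (i , k))) (toℕ k)

  -- The first condition makes the flip a unit step, the second makes it a step towards `f x`. Flips
  -- of enabled bits at states of X are exactly the edges of the asynchronous dynamics.
  Enabled : Vec ℕ n → I → Set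
  Enabled x j@(i , k) = lookup x i ≡ beside (bit x j) (toℕ k) × bit (f x) j ≢ bit x j

  Enabled? : ∀ x j → Dec (Enabled x j)
  Enabled? x j@(i , k) = (lookup x i ≟ beside (bit x j) (toℕ k)) ×-dec ¬? (bit (f x) j ≟ᵇ bit x j)

  lookup-move : ∀ x j {i} → i ≢ proj₁ j → lookup (move x j) i ≡ lookup x i
  lookup-move x j i≢ = lookup∘update′ i≢ x _

  bit-move : ∀ x j → bit (move x j) j ≡ not (bit x j)
  bit-move x j@(i , k) =
    trans (cong (λ v → exceeds v (toℕ k)) (lookup∘update i x _)) (exceeds-beside (not (bit x j)) (toℕ k))

  -- Within one component, the two levels beside a threshold are separated by that threshold only.
  bit-move-≢ : ∀ {x j l} → Enabled x j → l ≢ j → bit (move x j) l ≡ bit x l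
  bit-move-≢ {x} {j@(i , k)} {i′ , k′} (x≡ , _) l≢j with i′ Fin.≟ i
  ... | no i′≢i = cong (λ v → exceeds v (toℕ k′)) (lookup-move x j i′≢i)
  ... | yes refl = begin
    exceeds (lookup (move x j) i) (toℕ k′)           ≡⟨ cong (λ v → exceeds v (toℕ k′)) (lookup∘update i x _) ⟩
    exceeds (beside (not (bit x j)) (toℕ k)) (toℕ k′) ≡⟨ exceeds-beside-≢ (not (bit x j)) k′≢k ⟩
    exceeds (toℕ k) (toℕ k′)                         ≡⟨ exceeds-beside-≢ (bit x j) k′≢k ⟨
    exceeds (beside (bit x j) (toℕ k)) (toℕ k′)      ≡⟨ cong (λ v → exceeds v (toℕ k′)) x≡ ⟨
    exceeds (lookup x i) (toℕ k′)                    ∎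
    where
    open ≡-Reasoning
    k′≢k : toℕ k′ ≢ toℕ k
    k′≢k eq = l≢j (cong (i ,_) (toℕ-injective eq))

  threshold-below : ∀ x {i a} → InX x → a < lookup x i → ∃[ k ] suc (toℕ {m i} k) ≡ lookup x i
  threshold-below x {i} x∈X a<x with lookup x i | x∈X i
  ... | suc b | b<m = fromℕ< b<m , cong suc (toℕ-fromℕ< b<m)

  -- Since thresholds are indexed from 0, an upward step crosses threshold `x_i`, and a downward
  -- step (in `down`) threshold `x_i - 1`.
  up : ∀ {x i} k → toℕ k ≡ lookup x i → lookup x i < lookup (f x) i →
       bit x (i , k) ≡ false × Enabled x (i , k)
  up {x} {i} k k≡ x<f = X≡ , trans (sym k≡) (sym (cong (λ b → beside b (toℕ k)) X≡)) , F≢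
    where
    X≡ : bit x (i , k) ≡ false
    X≡ = ≤⇒¬exceeds (≤-reflexive (sym k≡))
    F≢ : bit (f x) (i , k) ≢ bit x (i , k)
    F≢ eq = contradiction (trans (sym (<⇒exceeds {lookup (f x) i} (subst (_< lookup (f x) i) (sym k≡) x<f)))
      (trans eq X≡)) λ ()

  down : ∀ {x i} k → suc (toℕ k) ≡ lookup x i → lookup (f x) i < lookup x i →
         bit x (i , k) ≡ true × Enabled x (i , k)
  down {x} {i} k k≡ f<x = X≡ , trans (sym k≡) (sym (cong (λ b → beside b (toℕ k)) X≡)) , F≢
    where
    X≡ : bit x (i , k) ≡ true
    X≡ = <⇒exceeds (≤-reflexive k≡)
    F≢ : bit (f x) (i , k) ≢ bit x (i , k)
    F≢ eq = contradiction (trans (sym (trans eq X≡))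
      (≤⇒¬exceeds {lookup (f x) i} (≤-pred (subst (lookup (f x) i <_) (sym k≡) f<x)))) λ ()

  enabled⇒edge : ∀ {x j} → InX x → Enabled x j → ADEdge x (move x j)
  enabled⇒edge {x} {j@(i , k)} x∈X (x≡ , F≢) with bit x j in X≡
  ... | true  = x∈X , i , - (+ 1) , sym (sgn-difference-< f<x) , (λ ()) ,
                cong (x [ i ]≔_) (cong (λ v → ℤ.∣ + v ℤ.+ - (+ 1) ∣) (sym x≡))
    where
    f<x : lookup (f x) i < lookup x i
    f<x = ≤-<-trans (exceeds-false _ (toℕ k) (¬-not F≢)) (exceeds-true _ _ X≡)
  ... | false = x∈X , i , + 1 , sym (sgn-difference-> x<f) , (λ ()) ,
                cong (x [ i ]≔_) (trans (+-comm 1 (toℕ k)) (cong (_+ 1) (sym x≡)))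
    where
    x<f : lookup x i < lookup (f x) i
    x<f = ≤-<-trans (exceeds-false _ (toℕ k) X≡) (exceeds-true _ (toℕ k) (¬-not F≢))

  edge⇒enabled : ∀ {x y} → ADEdge x y → ∃[ j ] (Enabled x j × y ≡ move x j)
  edge⇒enabled {x} (x∈X , i , s , s≡ , s≢0 , refl) with <-cmp (lookup x i) (lookup (f x) i)
  ... | tri≈ _ eq _ = contradiction
          (trans s≡ (trans (cong (λ v → sgn (+ lookup (f x) i ℤ.- + v)) eq) (sgn-difference-≡ (lookup (f x) i)))) s≢0
  ... | tri< x<f _ _ = let X≡ , en = up {x} k k≡ x<f in
          (i , k) , en , cong (x [ i ]≔_) (begin
            ℤ.∣ + lookup x i ℤ.+ s ∣              ≡⟨ cong (λ r → ℤ.∣ + lookup x i ℤ.+ r ∣) (trans s≡ (sgn-difference-> x<f)) ⟩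
            lookup x i + 1                       ≡⟨ +-comm (lookup x i) 1 ⟩
            suc (lookup x i)                     ≡⟨ cong suc k≡ ⟨
            suc (toℕ k)                          ≡⟨ cong (λ b → beside (not b) (toℕ k)) X≡ ⟨
            beside (not (bit x (i , k))) (toℕ k) ∎)
    where
    open ≡-Reasoning
    x<m : lookup x i < m i
    x<m = <-≤-trans x<f (f-InX x x∈X i)
    k = fromℕ< x<m
    k≡ : toℕ k ≡ lookup x i
    k≡ = toℕ-fromℕ< x<m
  ... | tri> _ _ f<x = let X≡ , en = down {x} k k≡ f<x in
          (i , k) , en , cong (x [ i ]≔_) (begin
            ℤ.∣ + lookup x i ℤ.+ s ∣              ≡⟨ cong (λ r → ℤ.∣ + lookup x i ℤ.+ r ∣) (trans s≡ (sgn-difference-< f<x)) ⟩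
            ℤ.∣ + lookup x i ℤ.+ - (+ 1) ∣        ≡⟨ cong (λ v → ℤ.∣ + v ℤ.+ - (+ 1) ∣) k≡ ⟨
            toℕ k                                ≡⟨ cong (λ b → beside (not b) (toℕ k)) X≡ ⟨
            beside (not (bit x (i , k))) (toℕ k) ∎)
    where
    open ≡-Reasoning
    k = proj₁ (threshold-below x x∈X f<x)
    k≡ = proj₂ (threshold-below x x∈X f<x)

  -- Component `i` has to cross threshold `l` on its way to `f x`; `k` is the first threshold in
  -- that direction.
  toward : ∀ {x i} l → InX x → bit (f x) (i , l) ≢ bit x (i , l) →
    ∃[ k ] (Enabled x (i , k) × bit x (i , k) ≡ bit x (i , l))
  toward {x} {i} l x∈X F≢X with bit x (i , l) in X≡
  ... | false = let Xk , en = up {x} k k≡ x<f in k , en , Xk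
    where
    x≤l : lookup x i ≤ toℕ l
    x≤l = exceeds-false _ (toℕ l) X≡
    x<f : lookup x i < lookup (f x) i
    x<f = ≤-<-trans x≤l (exceeds-true _ (toℕ l) (¬-not F≢X))
    x<m : lookup x i < m i
    x<m = ≤-<-trans x≤l (toℕ<n l)
    k = fromℕ< x<m
    k≡ : toℕ k ≡ lookup x i
    k≡ = toℕ-fromℕ< x<m
  ... | true = let Xk , en = down {x} k k≡ f<x in k , en , Xk
    where
    f<x : lookup (f x) i < lookup x i
    f<x = ≤-<-trans (exceeds-false _ (toℕ l) (¬-not F≢X)) (exceeds-true _ (toℕ l) X≡)
    k = proj₁ (threshold-below x x∈X f<x)
    k≡ = proj₂ (threshold-below x x∈X f<x)

  -- The attractor and its influences

  module _ (C : Vec ℕ n → Set) (attractor : Attractor C) where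

    private
      trap    = proj₁ attractor
      minimal = proj₂ attractor
      x₀      = proj₁ (proj₁ trap)
      x₀∈C    = proj₂ (proj₁ trap)

    C⇒InX : ∀ {x} → C x → InX x
    C⇒InX = proj₁ (proj₂ trap) _

    C-edge : ∀ {x y} → C x → ADEdge x y → C y
    C-edge = proj₂ (proj₂ trap) _ _

    C-star : ∀ {x y} → C x → Star ADEdge x y → C y
    C-star x∈C ε       = x∈C
    C-star x∈C (e ◅ p) = C-star (C-edge x∈C e) p

    C-move : ∀ {x j} → C x → Enabled x j → C (move x j)
    C-move x∈C en = C-edge x∈C (enabled⇒edge (C⇒InX x∈C) en)

    -- The states reachable from `x` form a trap set inside `C`, so minimality applies to them.
    C-connected : ∀ {x y} → C x → C y → Star ADEdge x y
    C-connected {x} x∈C = minimal (Star ADEdge x)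
      ((x , ε) , (λ _ p → C⇒InX (C-star x∈C p)) , (λ _ _ p e → p ◅◅ e ◅ ε))
      (λ _ → C-star x∈C) _

    ADEdge? : Decidable ADEdge
    ADEdge? x y = map′ to from
        (all? (λ i → lookup x i ≤? m i) ×-dec any? (λ j → Enabled? x j ×-dec ≡-dec _≟_ y (move x j)) coords)
      where
      to : InX x × Any (λ j → Enabled x j × y ≡ move x j) coords → ADEdge x y
      to (x∈X , found) with find found
      ... | _ , _ , en , refl = enabled⇒edge x∈X en
      from : ADEdge x y → InX x × Any (λ j → Enabled x j × y ≡ move x j) coords
      from e = proj₁ e , let j , p = edge⇒enabled e in lose (∈-coords j) p

    -- `C` is an arbitrary predicate, but it coincides with reachability from `x₀` in a finite
    -- graph. This makes influences decidable in turn.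
    C? : ∀ x → Dec (C x)
    C? x = map′ (C-star x₀∈C) (C-connected x₀∈C) (R.reachable? x₀ x)
      where module R = Reachability (≡-dec _≟_) ADEdge? (box n m) (λ e → ∈-box _ (proj₁ e))

    -- The edges of G_{f^b}(β(C)) seen along transitions inside C.
    Influence : I → I → Sign → Set
    Influence j l s = ∃[ x ] (C x × Enabled x j × bit (f (move x j)) l ≢ bit (f x) l ×
                              s ≡ sg (bit x j) · sg (bit (f x) l))

    Influence? : ∀ j l s → Dec (Influence j l s)
    Influence? j l s = map′ (λ p → let x , _ , q = find p in x , q)
                            (λ (x , q) → lose (∈-box x (C⇒InX (proj₁ q))) q)
      (any? (λ x → C? x ×-dec (Enabled? x j ×-dec (¬? (bit (f (move x j)) l ≟ᵇ bit (f x) l)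
                        ×-dec (s ≟ₛ sg (bit x j) · sg (bit (f x) l))))) (box n m))

    influence⇒GEdge : ∀ {j l s} → Influence j l s → GEdge C j l (s ◃ 1)
    influence⇒GEdge {j} {l} (x , x∈C , en , F≢ , refl) =
      x , x∈C , sg (not (bit x j)) ◃ 1 , sg-±1 (not (bit x j)) , move x j ,
      C⇒InX (C-move x∈C en) ,
      trans (cong toℤ (bit-move x j)) (toℤ-not (bit x j)) ,
      (λ k k≢j → cong toℤ (bit-move-≢ {x} en k≢j)) ,
      sg-product (bit x j) F≢ , ◃1≢0 _

    open SignedGraph _≟ᴵ_ Influence

    negCycle⇒NegativeCycle : NegCycle → NegativeCycle (GEdge C)
    negCycle⇒NegativeCycle (k , v , s , inj , edges , neg) =
      k , v , (λ t → s t ◃ 1) , inj , (λ t → influence⇒GEdge (edges t)) ,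
      trans (prodFin-signs s) (cong (_◃ 1) neg)

    -- The double cover and its initial component

    nodes : List (I × Sign)
    nodes = cartesianProduct coords (Sign.+ ∷ Sign.- ∷ [])

    ∈-nodes : ∀ p → p ∈ nodes
    ∈-nodes (l , Sign.+) = ∈-cartesianProduct⁺ (∈-coords l) (here refl)
    ∈-nodes (l , Sign.-) = ∈-cartesianProduct⁺ (∈-coords l) (there (here refl))

    open Reachability {E = DoubleCover} (Product.≡-dec _≟ᴵ_ _≟ₛ_)
      (λ (j , δ) (l , η) → Influence? j l (δ · η)) nodes (λ _ → ∈-nodes _)

    -- K l δ says that the coordinate l lies in an initial strong component, with label δ;
    -- every influence j → l inside the component has the product of the two labels as its sign.
    module Component (p̂ : I × Sign)
      (consistent : ∀ {l δ η} → Star DoubleCover (l , δ) p̂ → Star DoubleCover (l , η) p̂ → δ ≡ η) where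

      K : I → Sign → Set
      K l δ = Star DoubleCover (l , δ) p̂

      K? : ∀ l → Dec (∃[ δ ] K l δ)
      K? l with reachable? (l , Sign.+) p̂ | reachable? (l , Sign.-) p̂
      ... | yes p | _     = yes (_ , p)
      ... | no _  | yes p = yes (_ , p)
      ... | no ¬p | no ¬q = no λ where
        (Sign.+ , p) → ¬p p
        (Sign.- , q) → ¬q q

      -- `K` is closed under predecessors in the double cover, and the sign of the influence
      -- determines the label of the predecessor.
      influencer : ∀ {x j l η} → C x → Enabled x j → K l η →
        bit (f (move x j)) l ≢ bit (f x) l →
        ∃[ δ ] (K j δ × sg (bit x j) · δ ≡ sg (bit (f x) l) · η)
      influencer {x} {j} {l} {η} x∈C en l∈K F≢ =
        (a · b) · η ,
        (x , x∈C , en , F≢ ,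
          trans (·-assoc (a · b) η η) (trans (cong ((a · b) ·_) (s*s≡+ η)) (·-identityʳ (a · b)))) ◅ l∈K ,
        trans (cong (a ·_) (·-assoc a b η)) (trans (sym (·-assoc a a (b · η))) (cong (_· (b · η)) (s*s≡+ a)))
        where
        a = sg (bit x j)
        b = sg (bit (f x) l)

      stable-outside : ∀ {x j l η} → C x → Enabled x j → ¬ (∃[ δ ] K j δ) → K l η →
        bit (f (move x j)) l ≡ bit (f x) l
      stable-outside x∈C en j∉K l∈K = decidable-stable (_ ≟ᵇ _) λ F≢ →
        let δ , j∈K , _ = influencer x∈C en l∈K F≢ in j∉K (δ , j∈K)

      -- This is monotonicity: weighting bits by their labels, a flip of `j` can change `f` only at
      -- coordinates whose image has the weighted value that `j` is leaving.
      stable-against : ∀ {x j δ l η} → C x → Enabled x j → K j δ → K l η →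
        sg (bit (f x) l) · η ≢ sg (bit x j) · δ → bit (f (move x j)) l ≡ bit (f x) l
      stable-against {x} {j} x∈C en j∈K l∈K against = decidable-stable (_ ≟ᵇ _) λ F≢ →
        let δ′ , j∈K′ , eq = influencer x∈C en l∈K F≢
        in against (trans (sym eq) (cong (sg (bit x j) ·_) (consistent j∈K′ j∈K)))

      AgreeOnK : Vec ℕ n → Vec ℕ n → Set
      AgreeOnK x y = ∀ {l η} → K l η → bit y l ≡ bit x l × bit (f y) l ≡ bit (f x) l

      agree-outside : ∀ {x j} → C x → Enabled x j → ¬ (∃[ δ ] K j δ) → AgreeOnK x (move x j)
      agree-outside {x} x∈C en j∉K {l} l∈K =
        bit-move-≢ {x} en (λ l≡j → j∉K (_ , subst (λ j → K j _) l≡j l∈K)) , stable-outside x∈C en j∉K l∈K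

      -- Tuning the bits of K

      TunedOn : (Fin n → Set) → Vec ℕ n → Set
      TunedOn P x = ∀ {l η} → K l η → P (proj₁ l) → bit (f x) l ≡ bit x l

      tuned? : ∀ {P : Fin n → Set} → U.Decidable P → ∀ x →
        TunedOn P x ⊎ ∃[ l ] ∃[ η ] (K l η × P (proj₁ l) × bit (f x) l ≢ bit x l)
      tuned? P? x with any? (λ l → K? l ×-dec (P? (proj₁ l) ×-dec ¬? (bit (f x) l ≟ᵇ bit x l))) coords
      ... | yes found = let l , _ , (η , l∈K) , q = find found in inj₂ (l , η , l∈K , q)
      ... | no ¬found = inj₁ λ {l} l∈K l∈P → decidable-stable (_ ≟ᵇ _) λ F≢ →
              ¬found (lose (∈-coords l) ((_ , l∈K) , l∈P , F≢))

      -- Transitions flipping coordinates outside K change neither x nor f on K,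
      -- hence component i may be moved until it is about to flip a coordinate in K.
      approach : ∀ {x l η} → C x → K l η → bit (f x) l ≢ bit x l →
        ∃[ y ] (C y × AgreeOnK x y × (∀ i → i ≢ proj₁ l → lookup y i ≡ lookup x i) ×
          ∃[ j ] ∃[ δ ] (K j δ × proj₁ j ≡ proj₁ l × Enabled y j))
      approach {x} {i , k} x∈C l∈K F≢ =
        -- A crude bound that serves both directions.
        go (suc (toℕ k) + lookup x i) x∈C F≢
          ( (λ _ → ≤-trans (m≤m+n (suc (toℕ k)) (lookup x i)) (m≤n+m _ (lookup x i)))
          , (λ _ → ≤-trans (m≤n+m (lookup x i) (suc (toℕ k))) (m≤n+m _ (toℕ k))))
        where
        -- `N` unit steps towards threshold `k` would flip the bit `(i , k)`. Flips outside `K`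
        -- preserve that bit, so with `N = 0` the bound is contradictory.
        DistanceBound : ℕ → Vec ℕ n → Set
        DistanceBound N x = (bit x (i , k) ≡ false → toℕ k < lookup x i + N)
                          × (bit x (i , k) ≡ true → lookup x i ≤ toℕ k + N)

        closer : ∀ {N x} k′ → Enabled x (i , k′) → bit x (i , k′) ≡ bit x (i , k) →
          bit (move x (i , k′)) (i , k) ≡ bit x (i , k) →
          DistanceBound (suc N) x → DistanceBound N (move x (i , k′))
        closer {N} {x} k′ (x≡ , _) same kept (below , above) =
          (λ X≡ → subst (toℕ k <_) (trans (+-suc (lookup x i) N) (cong (_+ N) (suc-level X≡)))
                        (below (trans (sym kept) X≡))) ,
          (λ X≡ → s≤s⁻¹ (subst₂ _≤_ (level-suc X≡) (+-suc (toℕ k) N) (above (trans (sym kept) X≡))))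
          where
          y≡ : lookup (move x (i , k′)) i ≡ beside (not (bit x (i , k′))) (toℕ k′)
          y≡ = lookup∘update i x _
          suc-level : bit (move x (i , k′)) (i , k) ≡ false → suc (lookup x i) ≡ lookup (move x (i , k′)) i
          suc-level X≡ = let b≡ = trans same (trans (sym kept) X≡) in
            trans (cong suc (trans x≡ (cong (λ b → beside b (toℕ k′)) b≡)))
                  (sym (trans y≡ (cong (λ b → beside (not b) (toℕ k′)) b≡)))
          level-suc : bit (move x (i , k′)) (i , k) ≡ true → lookup x i ≡ suc (lookup (move x (i , k′)) i)
          level-suc X≡ = let b≡ = trans same (trans (sym kept) X≡) in
            trans (trans x≡ (cong (λ b → beside b (toℕ k′)) b≡))
                  (cong suc (sym (trans y≡ (cong (λ b → beside (not b) (toℕ k′)) b≡))))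

        go : ∀ N {x} → C x → bit (f x) (i , k) ≢ bit x (i , k) → DistanceBound N x →
          ∃[ y ] (C y × AgreeOnK x y × (∀ i′ → i′ ≢ i → lookup y i′ ≡ lookup x i′) ×
            ∃[ j ] ∃[ δ ] (K j δ × proj₁ j ≡ i × Enabled y j))
        go zero {x} x∈C F≢ (below , above) with bit x (i , k) in X≡
        ... | true  = contradiction (exceeds-true _ (toℕ k) X≡)
                        (≤⇒≯ (subst (lookup x i ≤_) (+-identityʳ (toℕ k)) (above refl)))
        ... | false = contradiction (subst (toℕ k <_) (+-identityʳ (lookup x i)) (below refl))
                        (≤⇒≯ (exceeds-false _ (toℕ k) X≡))
        go (suc N) {x} x∈C F≢ bound with toward k (C⇒InX x∈C) F≢
        ... | k′ , en , same with K? (i , k′)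
        ...   | yes (δ , j∈K) = x , x∈C , (λ _ → refl , refl) , (λ _ _ → refl) , (i , k′) , δ , j∈K , refl , en
        ...   | no j∉K =
          let agree     = agree-outside x∈C en j∉K
              X≡ , F≡   = agree l∈K
              y , y∈C , agree′ , rest , flip =
                go N (C-move x∈C en) (λ eq → F≢ (trans (sym F≡) (trans eq X≡))) (closer k′ en same X≡ bound)
          in y , y∈C ,
             (λ q → trans (proj₁ (agree′ q)) (proj₁ (agree q)) , trans (proj₂ (agree′ q)) (proj₂ (agree q))) ,
             (λ i′ i′≢i → trans (rest i′ i′≢i) (lookup-move x (i , k′) i′≢i)) , flip

      -- The heights sg (bit x l) · η orient the bits of K so that f becomes increasing on K.
      -- If no bit of K in P has height ρ against the will of f, then moving the components in P
      -- towards f only produces bits of height ρ, and f keeps all its bits of height ρ.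
      Rising : (Fin n → Set) → Sign → Vec ℕ n → Set
      Rising P ρ x = ∀ {l η} → K l η → P (proj₁ l) → sg (bit x l) · η ≡ ρ → sg (bit (f x) l) · η ≡ ρ

      KeepsHeight : Sign → Vec ℕ n → Vec ℕ n → Set
      KeepsHeight ρ x y = ∀ {l η} → K l η → sg (bit (f x) l) · η ≡ ρ → sg (bit (f y) l) · η ≡ ρ

      remove : I → List I → List I
      remove j = filter (λ l → ¬? (l ≟ᴵ j))

      length-remove : ∀ {N j ls} → j ∈ ls → length ls ≤ suc N → length (remove j ls) ≤ N
      length-remove {j = j} {ls} j∈ls len =
        s≤s⁻¹ (≤-trans (filter-notAll (λ l → ¬? (l ≟ᴵ j)) ls (lose j∈ls λ j≢j → j≢j refl)) len)

      ∈-remove : ∀ {j l ls} → l ∈ ls → l ≢ j → l ∈ remove j ls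
      ∈-remove {j} = ∈-filter⁺ (λ l → ¬? (l ≟ᴵ j))

      ¬length≤0 : ∀ {j : I} {ls} → j ∈ ls → ¬ (length ls ≤ 0)
      ¬length≤0 (here _)  ()
      ¬length≤0 (there _) ()

      module _ {P : Fin n → Set} (P? : U.Decidable P) (ρ : Sign) where

        -- No bit of K in P leaves the height ρ again, so every round shortens ls.
        cascade′ : ∀ N ls → length ls ≤ N → ∀ {x} → C x → Rising P ρ x →
          (∀ {l η} → K l η → P (proj₁ l) → sg (bit x l) · η ≢ ρ → l ∈ ls) →
          ∃[ y ] (C y × TunedOn P y × (∀ i → ¬ P i → lookup y i ≡ lookup x i) × KeepsHeight ρ x y)
        cascade′ N ls len {x} x∈C rising pending with tuned? P? x
        ... | inj₁ tuned = x , x∈C , tuned , (λ _ _ → refl) , λ _ h → h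
        ... | inj₂ (l , η , l∈K , l∈P , F≢) with approach x∈C l∈K F≢
        ...   | y , y∈C , agree , rest , j , δ , j∈K , j~l , en = continue N len
          where
          j∈P : P (proj₁ j)
          j∈P = subst P (sym j~l) l∈P

          rising-y : Rising P ρ y
          rising-y {η = η} q q∈P h = let X≡ , F≡ = agree q in
            trans (cong (λ b → sg b · η) F≡) (rising q q∈P (trans (cong (λ b → sg b · η) (sym X≡)) h))

          -- At height `ρ` the bit would already agree with `f` and could not be enabled.
          Xj≢ρ : sg (bit y j) · δ ≢ ρ
          Xj≢ρ h = proj₂ en (sg-injective (·-cancelʳ δ _ _ (trans (rising-y j∈K j∈P h) (sym h))))

          Fj≡ρ : sg (bit (f y) j) · δ ≡ ρ
          Fj≡ρ = sg-flips (≢-sym (proj₂ en)) Xj≢ρ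

          -- The flip leaves the height opposite to `ρ`, so it can disturb only images at that
          -- height.
          keeps-move : KeepsHeight ρ y (move y j)
          keeps-move {η = η} q h = trans
            (cong (λ b → sg b · η) (stable-against y∈C en j∈K q λ h′ → Xj≢ρ (trans (sym h′) h))) h

          keeps : KeepsHeight ρ x (move y j)
          keeps {η = η} q h = keeps-move q (trans (cong (λ b → sg b · η) (proj₂ (agree q))) h)

          rising-move : Rising P ρ (move y j)
          rising-move {q} {η} q∈K q∈P h with q ≟ᴵ j
          -- The flipped bit arrives where `f` already had it.
          ... | yes refl = keeps-move q∈K (subst (λ η → sg (bit (f y) j) · η ≡ ρ) (consistent j∈K q∈K) Fj≡ρ)
          ... | no q≢j = keeps-move q∈K
                  (rising-y q∈K q∈P (trans (cong (λ b → sg b · η) (sym (bit-move-≢ {y} en q≢j))) h))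

          j∈ls : j ∈ ls
          j∈ls = pending j∈K j∈P λ h → Xj≢ρ (trans (cong (λ b → sg b · δ) (proj₁ (agree j∈K))) h)

          pending-move : ∀ {q η} → K q η → P (proj₁ q) → sg (bit (move y j) q) · η ≢ ρ → q ∈ remove j ls
          pending-move {q} {η} q∈K q∈P h≢ with q ≟ᴵ j
          ... | yes refl = contradiction
                  (trans (cong (λ b → sg b · η) (trans (bit-move y j) (sym (¬-not (proj₂ en)))))
                         (subst (λ η → sg (bit (f y) j) · η ≡ ρ) (consistent j∈K q∈K) Fj≡ρ)) h≢
          ... | no q≢j = ∈-remove (pending q∈K q∈P λ h → h≢
                  (trans (cong (λ b → sg b · η) (trans (bit-move-≢ {y} en q≢j) (proj₁ (agree q∈K)))) h)) q≢j

          continue : ∀ N → length ls ≤ N →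
            ∃[ z ] (C z × TunedOn P z × (∀ i → ¬ P i → lookup z i ≡ lookup x i) × KeepsHeight ρ x z)
          -- The bound is matched only now, when `j∈ls` shows that the list is nonempty.
          continue zero    len = contradiction len (¬length≤0 j∈ls)
          continue (suc N) len =
            let z , z∈C , tuned , rest′ , keeps′ = cascade′ N (remove j ls) (length-remove j∈ls len)
                                                     (C-move y∈C en) rising-move pending-move
            in z , z∈C , tuned ,
               (λ i i∉P → trans (rest′ i i∉P)
                 (trans (lookup-move y j (λ i≡ → i∉P (subst P (sym i≡) j∈P)))
                        (rest i (λ i≡ → i∉P (subst P (sym i≡) l∈P))))) ,
               (λ q h → keeps′ q (keeps q h))

        cascade : ∀ {x} → C x → Rising P ρ x →
          ∃[ y ] (C y × TunedOn P y × (∀ i → ¬ P i → lookup y i ≡ lookup x i) × KeepsHeight ρ x y)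
        cascade x∈C rising = cascade′ (length coords) coords ≤-refl x∈C rising (λ {l} _ _ _ → ∈-coords l)

      -- The tuned components P follow each move of a further component c in a cascade. The cascade
      -- preserves f at the bit j just flipped by c, so that c never overshoots its target.
      module _ {P : Fin n → Set} (P? : U.Decidable P) (c : Fin n) (c∉P : ¬ P c) where

        -- The invariant against overshooting: bits of `c` in `K` that have reached `b` are not
        -- called back, so `c` moves in one direction only.
        Leans : Bool → Vec ℕ n → Set
        Leans b x = ∀ {l η} → K l η → proj₁ l ≡ c → bit x l ≡ b → bit (f x) l ≡ b

        bit-chain : ∀ {x y} j l b → proj₁ j ≡ c → proj₁ l ≡ c →
          bit x j ≡ b → bit y j ≢ b → bit y l ≡ b → bit x l ≡ b
        bit-chain {x} {y} (_ , k) (_ , k′) b refl refl = exceeds-chain {lookup x c} {lookup y c} (toℕ k) (toℕ k′) b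

        bit-cong : ∀ {x y} l → lookup x (proj₁ l) ≡ lookup y (proj₁ l) → bit x l ≡ bit y l
        bit-cong (_ , k) = cong (λ v → exceeds v (toℕ k))

        tuneNext′ : ∀ b N ls → length ls ≤ N → ∀ {x} → C x → TunedOn P x → Leans b x →
          (∀ {l η} → K l η → proj₁ l ≡ c → bit x l ≢ b → l ∈ ls) →
          ∃[ y ] (C y × TunedOn P y × TunedOn (_≡ c) y)
        tuneNext′ b N ls len {x} x∈C tunedP leans pending with tuned? (Fin._≟ c) x
        ... | inj₁ tunedc = x , x∈C , tunedP , tunedc
        ... | inj₂ (l , η , l∈K , l~c , F≢) with approach x∈C l∈K F≢
        ...   | y , y∈C , agree , rest , j , δ , j∈K , j~l , en = continue N len
          where
          j~c : proj₁ j ≡ c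
          j~c = trans j~l l~c

          Xj≢b : bit y j ≢ b
          Xj≢b X≡ = let X~ , F~ = agree j∈K in
            proj₂ en (trans (trans F~ (leans j∈K j~c (trans (sym X~) X≡))) (sym X≡))

          Xj′≡b : bit (move y j) j ≡ b
          Xj′≡b = trans (bit-move y j) (sym (¬-not (≢-sym Xj≢b)))

          Fj≡b : bit (f y) j ≡ b
          Fj≡b = trans (¬-not (proj₂ en)) (sym (¬-not (≢-sym Xj≢b)))

          -- The height at which `j` arrives fixes the direction of the cascade.
          ρ : Sign
          ρ = sg b · δ

          keeps-move : KeepsHeight ρ y (move y j)
          keeps-move {η = η} q h = trans (cong (λ a → sg a · η) (stable-against y∈C en j∈K q λ h′ →
            Xj≢b (sg-injective (·-cancelʳ δ _ _ (trans (sym h′) h))))) h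

          -- Before the flip `f` fixed the bits of `K` in `P`, and the flip of `j` preserves images
          -- at height `ρ`.
          rising : Rising P ρ (move y j)
          rising {q} {η} q∈K q∈P h = keeps-move q∈K (trans (cong (λ a → sg a · η) tuned-q) h)
            where
            q≢j : q ≢ j
            q≢j q≡j = c∉P (subst P (trans (cong proj₁ q≡j) j~c) q∈P)
            tuned-q : bit (f y) q ≡ bit (move y j) q
            tuned-q = let X~ , F~ = agree q∈K in
              trans F~ (trans (tunedP q∈K q∈P) (trans (sym X~) (sym (bit-move-≢ {y} en q≢j))))

          j∈ls : j ∈ ls
          j∈ls = pending j∈K j~c λ X≡ → Xj≢b (trans (proj₁ (agree j∈K)) X≡)

          continue : ∀ N → length ls ≤ N → ∃[ z ] (C z × TunedOn P z × TunedOn (_≡ c) z)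
          continue zero    len = contradiction len (¬length≤0 j∈ls)
          continue (suc N) len with cascade P? ρ (C-move y∈C en) rising
          ... | z , z∈C , tuned , rest′ , keeps =
            tuneNext′ b N (remove j ls) (length-remove j∈ls len) z∈C tuned leans-z pending-z
            where
            Xz : ∀ q → proj₁ q ≡ c → bit z q ≡ bit (move y j) q
            Xz q q~c = bit-cong {z} {move y j} q (rest′ _ (c∉P ∘ subst P q~c))

            -- `f` had `j` at `b` before the flip; the flip and the cascade both preserve images at
            -- height `ρ`, which for `j` means `b`.
            Fzj≡b : bit (f z) j ≡ b
            Fzj≡b = sg-injective (·-cancelʳ δ _ _
              (keeps j∈K (keeps-move j∈K (cong (λ a → sg a · δ) Fj≡b))))

            leans-z : Leans b z
            leans-z {q} q∈K q~c X≡ with q ≟ᴵ j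
            ... | yes refl = Fzj≡b
            -- Labels do not enter: `y` is beyond threshold `q` but not beyond `j` in direction `b`,
            -- so `f z`, being beyond `j`, is also beyond `q`.
            ... | no q≢j = bit-chain {f z} {y} j q b j~c q~c Fzj≡b Xj≢b
                    (trans (sym (bit-move-≢ {y} en q≢j)) (trans (sym (Xz q q~c)) X≡))

            pending-z : ∀ {q η} → K q η → proj₁ q ≡ c → bit z q ≢ b → q ∈ remove j ls
            pending-z {q} q∈K q~c X≢ with q ≟ᴵ j
            ... | yes refl = contradiction (trans (Xz q q~c) Xj′≡b) X≢
            ... | no q≢j = ∈-remove (pending q∈K q~c λ X≡ → X≢
                    (trans (Xz q q~c) (trans (bit-move-≢ {y} en q≢j) (trans (proj₁ (agree q∈K)) X≡)))) q≢j

        tuneNext : ∀ {x} → C x → TunedOn P x → ∃[ y ] (C y × TunedOn P y × TunedOn (_≡ c) y)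
        tuneNext {x} x∈C tunedP with tuned? (Fin._≟ c) x
        ... | inj₁ tunedc = x , x∈C , tunedP , tunedc
        ... | inj₂ (l , η , l∈K , l~c , F≢) =
          tuneNext′ (bit (f x) l) (length coords) coords ≤-refl x∈C tunedP
            -- The untuned bit `l` shows in which direction `f x` lies from `x` in component `c`.
            (λ {q} _ q~c → bit-chain {f x} {x} l q (bit (f x) l) l~c q~c refl (≢-sym F≢))
            (λ {q} _ _ _ → ∈-coords q)

      -- Tuned states are frozen on K

      tuneBelow : ∀ t → t ≤ n → ∃[ x ] (C x × TunedOn (λ i → toℕ i < t) x)
      tuneBelow zero    _   = x₀ , x₀∈C , λ _ ()
      tuneBelow (suc t) t<n =
        let x , x∈C , tuned = tuneBelow t (<⇒≤ t<n)
            c = fromℕ< t<n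
            y , y∈C , tuned< , tuned≡ = tuneNext (λ i → toℕ i <? t) c
              (<-irrefl (toℕ-fromℕ< t<n)) x∈C tuned
        in y , y∈C , λ {l} q l≤t → case m≤n⇒m<n∨m≡n (s≤s⁻¹ l≤t) of λ where
             (inj₁ l<t) → tuned< q l<t
             (inj₂ l≡t) → tuned≡ q (toℕ-injective (trans l≡t (sym (toℕ-fromℕ< t<n))))

      Tuned : Vec ℕ n → Set
      Tuned x = ∀ {l η} → K l η → bit (f x) l ≡ bit x l

      -- No bit of `K` is enabled at a tuned state, and a flip outside `K` alters neither the state
      -- nor `f` on `K`.
      tuned-star : ∀ {x y} → C x → Tuned x → Star ADEdge x y → Tuned y
      tuned-star x∈C tuned ε       = tuned
      tuned-star {x} x∈C tuned (e ◅ p) with edge⇒enabled e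
      ... | j , en , refl = tuned-star (C-move x∈C en)
              (λ q → let X~ , F~ = agree q in trans F~ (trans (tuned q) (sym X~))) p
        where
        agree : AgreeOnK x (move x j)
        agree = agree-outside x∈C en λ (_ , j∈K) → proj₂ en (tuned j∈K)

      disabled-in-K : ∀ {x l η} → C x → K l η → ¬ Enabled x l
      disabled-in-K x∈C l∈K en = let z , z∈C , tuned = tuneBelow n ≤-refl in
        proj₂ en (tuned-star z∈C (λ {l} q → tuned q (toℕ<n (proj₁ l))) (C-connected z∈C x∈C) l∈K)

    -- The negative cycle

    enabled⇒negCycle : ∀ {x j} → C x → Enabled x j → NegCycle
    enabled⇒negCycle {x} {j} x∈C en with initialVertex (j , Sign.+)
    ... | p̂@(l̂ , _) , p̂⇝j , initial
        with any? (λ l → reachable? (l , Sign.+) p̂ ×-dec reachable? (l , Sign.-) p̂) coords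
    ...   | yes found = let l , _ , p , q = find found in
              -- Both copies of `l` reach `p̂`, and by initiality `p̂` leads back to the negative
              -- one.
              negativeWalk⇒NegCycle (p ◅◅ initial (l , Sign.-) q)
    ...   | no ¬found = let y , y∈C , en′ = active p̂⇝j in
              contradiction en′ (Component.disabled-in-K p̂ consistent y∈C ε)
      where
      -- Either `l̂` is `j`, or the first edge is an influence of `l̂`, whose witness is a state of
      -- `C` where `l̂` flips.
      active : ∀ {δ} → Star DoubleCover (l̂ , δ) (j , Sign.+) → ∃[ y ] (C y × Enabled y l̂)
      active ε                          = x , x∈C , en
      active ((y , y∈C , en′ , _) ◅ _) = y , y∈C , en′

      consistent : ∀ {l δ η} → Star DoubleCover (l , δ) p̂ → Star DoubleCover (l , η) p̂ → δ ≡ η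
      consistent {l} {Sign.+} {Sign.+} _ _ = refl
      consistent {l} {Sign.-} {Sign.-} _ _ = refl
      consistent {l} {Sign.+} {Sign.-} p q = contradiction (lose (∈-coords l) (p , q)) ¬found
      consistent {l} {Sign.-} {Sign.+} p q = contradiction (lose (∈-coords l) (q , p)) ¬found

    cyclic⇒NegativeCycle : Cyclic C → NegativeCycle (GEdge C)
    cyclic⇒NegativeCycle (x , y , x∈C , y∈C , x≢y) with C-connected x∈C y∈C
    ... | ε     = contradiction refl x≢y
    ... | e ◅ _ = let _ , en , _ = edge⇒enabled e in negCycle⇒NegativeCycle (enabled⇒negCycle x∈C en)

theorem10 : (n : ℕ) (m : Fin n → ℕ) → (∀ i → 1 ≤ m i) →
    (f : Vec ℕ n → Vec ℕ n) → (∀ x → Network.InX n m x → Network.InX n m (f x)) →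
    (C : Vec ℕ n → Set) → Network.Dyn.Attractor n m f C → Network.Dyn.Cyclic n m f C →
    Network.Dyn.NegativeCycle n m f (Network.Dyn.GEdge n m f C)
theorem10 n m _ f f-InX C = Dynamics.cyclic⇒NegativeCycle n m f f-InX C
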